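{- Let $m,n$ be positive integers. The simplicial rook graph $\mathcal{SR}(m,n)$ is Hamiltonian, except in the cases $m=1$ and $(m,n)=(2,1)$.
   Context: For positive integers $m,n$, the simplicial rook graph $\mathcal{SR}(m,n)$ is the graph whose vertices are the vectors $(a_1,\dots,a_m)\in\mathbb{N}^m$ (nonnegative integer coordinates) with $a_1+\cdots+a_m=n$, two vertices being adjacent if and only if their vectors differ in exactly two coordinates. A graph is Hamiltonian if it has a cycle passing through every vertex exactly once. -}

module Defs where

open import Level using (0ℓ)
open import Data.Fin using (Fin)
open import Data.List using (List; _∷_; _∷ʳ_; length)
open import Data.List.Membership.Propositional using (_∈_)
open import Data.List.Relation.Unary.Linked using (Linked)
open import Data.List.Relation.Unary.Unique.Propositional using (Unique)
open import Data.Nat using (ℕ; _≤_)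
open import Data.Product using (Σ; ∃₂; _×_; _,_; proj₁)
open import Data.Sum using (_⊎_)
open import Data.Vec using (Vec; lookup; sum)
open import Relation.Binary.Core using (Rel)
open import Relation.Binary.Definitions using (Symmetric; Irreflexive)
open import Relation.Binary.PropositionalEquality using (_≡_; _≢_; refl; sym)

record Graph : Set₁ where
  infix 4 _~_
  field
    Vertex   : Set
    _~_      : Rel Vertex 0ℓ
    ~-sym    : Symmetric _~_
    ~-irrefl : Irreflexive _≡_ _~_

module _ (G : Graph) where
  open Graph G

  -- The cycle v₀, v₁, …, vₖ₋₁, v₀ is stored as start = v₀ and rest = v₁, …, vₖ₋₁.
  -- As usual for simple graphs, a cycle has at least three vertices; in
  -- particular K₁ and K₂ contain none.
  record Cycle : Set where
    field
      start : Vertex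
      rest  : List Vertex

    vertices : List Vertex
    vertices = start ∷ rest

    field
      long     : 3 ≤ length vertices
      distinct : Unique vertices
      closed   : Linked _~_ (vertices ∷ʳ start)

  Hamiltonian : Set
  Hamiltonian = Σ Cycle λ c → ∀ v → v ∈ Cycle.vertices c

DifferInExactlyTwo : ∀ {m} → Rel (Vec ℕ m) 0ℓ
DifferInExactlyTwo {m} a b = ∃₂ λ (i j : Fin m) →
  i ≢ j ×
  lookup a i ≢ lookup b i ×
  lookup a j ≢ lookup b j ×
  (∀ k → lookup a k ≢ lookup b k → k ≡ i ⊎ k ≡ j)

-- Equality proofs in ℕ are unique, so _≡_ on vertices is equality of the
-- underlying vectors.
SR : ℕ → ℕ → Graph
SR m n = record
  { Vertex   = Σ (Vec ℕ m) λ a → sum a ≡ n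
  ; _~_      = λ a b → DifferInExactlyTwo (proj₁ a) (proj₁ b)
  ; ~-sym    = λ { (i , j , i≢j , pᵢ , pⱼ , only) →
                   i , j , i≢j , (λ e → pᵢ (sym e)) , (λ e → pⱼ (sym e)) ,
                   λ k p → only k (λ e → p (sym e)) }
  ; ~-irrefl = λ { refl (_ , _ , _ , pᵢ , _) → pᵢ refl }
  }

{-# OPTIONS --safe #-}
-- Write e_first and e_last for the first and last unit vectors.  By induction on
-- the length of the vectors there is a Hamiltonian path from n·e_last to n·e_first:
-- run through the layers with head coordinate 0, 1, …, n, traversing each layer by
-- the path for shorter vectors, in alternating directions.  The end of a layer and
-- the start of the next one then agree after the head except in a single coordinate.
-- As n·e_last and n·e_first are adjacent, the path closes up to a cycle.
module Submission where

open import Defs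
open import Level using (0ℓ)
open import Data.Fin using (Fin; zero; suc)
open import Data.Fin.Properties using (suc-injective)
open import Data.List using (List; []; _∷_; [_]; _++_; _∷ʳ_; length; reverse)
  renaming (map to mapˡ)
open import Data.List.Membership.Propositional using (_∈_)
open import Data.List.Membership.Propositional.Properties
  using (∈-++⁺ˡ; ∈-++⁺ʳ; ∈-map⁺; ∈-map⁻)
open import Data.List.Properties using (unfold-reverse)
open import Data.List.Relation.Binary.Permutation.Propositional
  using (↭-sym; ↭⇒↭ₛ)
open import Data.List.Relation.Binary.Permutation.Propositional.Properties
  using (↭-reverse; All-resp-↭; ∈-resp-↭)
import Data.List.Relation.Binary.Permutation.Setoid.Properties as Permutationₛ
open import Data.List.Relation.Unary.All using (All; []; _∷_)
import Data.List.Relation.Unary.All as All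
import Data.List.Relation.Unary.All.Properties as All
import Data.List.Relation.Unary.AllPairs as AllPairs
import Data.List.Relation.Unary.AllPairs.Properties as AllPairs
open import Data.List.Relation.Unary.Any using (here; there)
open import Data.List.Relation.Unary.Linked using (Linked; [-]; _∷_)
open import Data.List.Relation.Unary.Unique.Propositional using (Unique; []; _∷_)
import Data.List.Relation.Unary.Unique.Propositional.Properties as Unique
open import Data.Nat using (ℕ; zero; suc; _+_; _≤_; NonZero; z≤n; s≤s; ≢-nonZero⁻¹)
open import Data.Nat.Properties
  using (≤-refl; ≤-antisym; ≤-reflexive; ≤-trans; n≤1+n; 1+n≰n; 1+n≢n; +-suc;
         +-identityʳ; +-cancelˡ-≡; m≤m+n; m≤n⇒m<n∨m≡n; ≡-irrelevant)
open import Data.Product using (∃; _×_; _,_; proj₁; proj₂)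
open import Data.Sum as Sum using (_⊎_; inj₁; inj₂)
open import Data.Unit using (⊤)
open import Data.Vec using (Vec; []; _∷_; lookup; sum; head; tail)
open import Data.Vec.Properties using (∷-injectiveʳ)
open import Function using (_∘_)
open import Function.Bundles using (_⇔_; mk⇔)
open import Relation.Binary.Core using (Rel)
open import Relation.Binary.Definitions using (Symmetric)
open import Relation.Binary.PropositionalEquality
  using (_≡_; _≢_; refl; sym; trans; cong; subst; setoid)
open import Relation.Nullary using (¬_; contradiction)
open import Relation.Unary using (Pred; _≐_; _∪_)

-- Walks with prescribed endpoints

infixr 5 _∷_

data Walk {A : Set} (_~_ : Rel A 0ℓ) : A → A → List A → Set where
  stop : ∀ x → Walk _~_ x x [ x ]
  _∷_  : ∀ {x y z ys} → x ~ y → Walk _~_ y z ys → Walk _~_ x z (x ∷ ys)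

module _ {A : Set} {_~_ : Rel A 0ℓ} where

  Walk-++ : ∀ {s t u v xs ys} → Walk _~_ s t xs → t ~ u → Walk _~_ u v ys →
            Walk _~_ s v (xs ++ ys)
  Walk-++ (stop _) e q = e ∷ q
  Walk-++ (f ∷ p)  e q = f ∷ Walk-++ p e q

  Walk-reverse : Symmetric _~_ → ∀ {s t xs} → Walk _~_ s t xs →
                 Walk _~_ t s (reverse xs)
  Walk-reverse ~-sym (stop x) = stop x
  Walk-reverse ~-sym (_∷_ {x} {ys = ys} e p) =
    subst (Walk _~_ _ _) (sym (unfold-reverse x ys))
      (Walk-++ (Walk-reverse ~-sym p) (~-sym e) (stop x))

  Walk-map : ∀ {B : Set} {_~′_ : Rel B 0ℓ} {f : A → B} →
             (∀ {x y} → x ~ y → f x ~′ f y) →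
             ∀ {s t xs} → Walk _~_ s t xs → Walk _~′_ (f s) (f t) (mapˡ f xs)
  Walk-map h (stop x) = stop _
  Walk-map h (e ∷ p)  = h e ∷ Walk-map h p

  Walk-start : ∀ {s t xs} → Walk _~_ s t xs → s ∈ xs
  Walk-start (stop _) = here refl
  Walk-start (_ ∷ _)  = here refl

  Walk-closed : ∀ {s t u xs} → Walk _~_ s t xs → t ~ u → Linked _~_ (xs ∷ʳ u)
  Walk-closed (stop _)        e = e ∷ [-]
  Walk-closed (f ∷ stop y)    e = f ∷ Walk-closed (stop y) e
  Walk-closed (f ∷ p@(_ ∷ _)) e = f ∷ Walk-closed p e

  -- The vertex `u` is a third one besides the two endpoints, which excludes walks with one or two
  -- vertices.
  Walk-long : ∀ {s t u xs} → Walk _~_ s t xs → s ≢ t → u ∈ xs → u ≢ s → u ≢ t →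
              3 ≤ length xs
  Walk-long (stop _)         s≢t _                   _   _   = contradiction refl s≢t
  Walk-long (_ ∷ stop _)     _   (here refl)         u≢s _   = contradiction refl u≢s
  Walk-long (_ ∷ stop _)     _   (there (here refl)) _   u≢t = contradiction refl u≢t
  Walk-long (_ ∷ _ ∷ stop _) _ _ _ _ = s≤s (s≤s (s≤s z≤n))
  Walk-long (_ ∷ _ ∷ _ ∷ _)  _ _ _ _ = s≤s (s≤s (s≤s z≤n))

-- Paths visiting exactly the elements of a set

module _ {A : Set} (_~_ : Rel A 0ℓ) where

  -- The set is a predicate on a fixed type `A` rather than a type of its own, so that paths through
  -- disjoint sets can be concatenated directly.
  record SpanningPath (P : Pred A 0ℓ) (s t : A) : Set where
    constructor spanning
    field
      {path}   : List A
      walk     : Walk _~_ s t path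
      distinct : Unique path
      sound    : All P path
      complete : ∀ {x} → P x → x ∈ path

module _ {A : Set} {_~_ : Rel A 0ℓ} where

  singleton : ∀ x → SpanningPath _~_ (_≡ x) x x
  singleton x = spanning (stop x) ([] ∷ []) (refl ∷ []) here

  resp-≐ : ∀ {P Q s t} → P ≐ Q → SpanningPath _~_ P s t → SpanningPath _~_ Q s t
  resp-≐ (P⊆Q , Q⊆P) (spanning w d a c) = spanning w d (All.map P⊆Q a) (c ∘ Q⊆P)

  -- Reversal permutes the list, and the three conditions on the list are invariant under
  -- permutation.
  reversed : Symmetric _~_ → ∀ {P s t} → SpanningPath _~_ P s t → SpanningPath _~_ P t s
  reversed ~-sym (spanning {xs} w d a c) = spanning
    (Walk-reverse ~-sym w)
    (Permutationₛ.Unique-resp-↭ (setoid A) (↭⇒↭ₛ σ) d)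
    (All-resp-↭ σ a)
    (∈-resp-↭ σ ∘ c)
    where σ = ↭-sym (↭-reverse xs)

  joined : ∀ {P Q s t u v} → (∀ {x} → P x → ¬ Q x) →
           SpanningPath _~_ P s t → t ~ u → SpanningPath _~_ Q u v →
           SpanningPath _~_ (P ∪ Q) s v
  joined disjoint (spanning {xs} w d a c) e (spanning w′ d′ a′ c′) = spanning
    (Walk-++ w e w′)
    (Unique.++⁺ d d′ λ (i , j) → disjoint (All.lookup a i) (All.lookup a′ j))
    (All.++⁺ (All.map inj₁ a) (All.map inj₂ a′))
    λ { (inj₁ p) → ∈-++⁺ˡ (c p) ; (inj₂ q) → ∈-++⁺ʳ xs (c′ q) }

-- Differences in one or two coordinates

DifferInExactlyOne : ∀ {m} → Rel (Vec ℕ m) 0ℓ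
DifferInExactlyOne {m} a b = ∃ λ (i : Fin m) →
  lookup a i ≢ lookup b i × (∀ k → lookup a k ≢ lookup b k → k ≡ i)

two-sym : ∀ {m} {a b : Vec ℕ m} → DifferInExactlyTwo a b → DifferInExactlyTwo b a
two-sym (i , j , i≢j , pᵢ , pⱼ , only) =
  i , j , i≢j , pᵢ ∘ sym , pⱼ ∘ sym , λ k p → only k (p ∘ sym)

∷-differ-one : ∀ {m x y} {v : Vec ℕ m} → x ≢ y → DifferInExactlyOne (x ∷ v) (y ∷ v)
∷-differ-one x≢y = zero , x≢y ,
  λ { zero _ → refl ; (suc k) p → contradiction refl p }

∷-same-differ-one : ∀ {m x} {v w : Vec ℕ m} → DifferInExactlyOne v w →
                    DifferInExactlyOne (x ∷ v) (x ∷ w)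
∷-same-differ-one (i , p , only) = suc i , p ,
  λ { zero q → contradiction refl q ; (suc k) q → cong suc (only k q) }

∷-differ-two : ∀ {m x y} {v w : Vec ℕ m} → x ≢ y → DifferInExactlyOne v w →
               DifferInExactlyTwo (x ∷ v) (y ∷ w)
∷-differ-two x≢y (i , p , only) = zero , suc i , (λ ()) , x≢y , p ,
  λ { zero _ → inj₁ refl ; (suc k) q → inj₂ (cong suc (only k q)) }

∷-same-differ-two : ∀ {m x} {v w : Vec ℕ m} → DifferInExactlyTwo v w →
                    DifferInExactlyTwo (x ∷ v) (x ∷ w)
∷-same-differ-two (i , j , i≢j , p , q , only) =
  suc i , suc j , i≢j ∘ suc-injective , p , q , λ where
    zero    r → contradiction refl r
    (suc k) r → Sum.map (cong suc) (cong suc) (only k r)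

-- The two corners of the simplex

lastCorner : ∀ m → ℕ → Vec ℕ (suc m)
lastCorner zero    n = n ∷ []
lastCorner (suc m) n = 0 ∷ lastCorner m n

-- lastCorner m 0 is the zero vector.
firstCorner : ∀ m → ℕ → Vec ℕ (suc m)
firstCorner zero    n = n ∷ []
firstCorner (suc m) n = n ∷ lastCorner m 0

corners-0 : ∀ m → firstCorner m 0 ≡ lastCorner m 0
corners-0 zero    = refl
corners-0 (suc m) = refl

sum-lastCorner : ∀ m n → sum (lastCorner m n) ≡ n
sum-lastCorner zero    n = +-identityʳ n
sum-lastCorner (suc m) n = sum-lastCorner m n

sum-firstCorner : ∀ m n → sum (firstCorner m n) ≡ n
sum-firstCorner zero    n = +-identityʳ n
sum-firstCorner (suc m) n = trans (cong (n +_) (sum-lastCorner m 0)) (+-identityʳ n)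

lastCorner-differ : ∀ m {n n′} → n ≢ n′ →
                    DifferInExactlyOne (lastCorner m n) (lastCorner m n′)
lastCorner-differ zero    p = ∷-differ-one p
lastCorner-differ (suc m) p = ∷-same-differ-one (lastCorner-differ m p)

firstCorner-differ : ∀ m {n n′} → n ≢ n′ →
                     DifferInExactlyOne (firstCorner m n) (firstCorner m n′)
firstCorner-differ zero    p = ∷-differ-one p
firstCorner-differ (suc m) p = ∷-differ-one p

-- Decomposition into layers by head coordinate

SumIs : ∀ {m} → ℕ → Pred (Vec ℕ m) 0ℓ
SumIs n v = sum v ≡ n

Layer : ∀ {m} → ℕ → Pred (Vec ℕ m) 0ℓ → Pred (Vec ℕ (suc m)) 0ℓ
Layer k P v = head v ≡ k × P (tail v)

-- These are the layers `k` to `k + r` of the vectors with sum `k + r`. Splitting the sum this way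
-- makes `r` the tail sum of layer `k` and lets recursion run on `r`.
HeadFrom : ∀ {m} → ℕ → ℕ → Pred (Vec ℕ (suc m)) 0ℓ
HeadFrom k r v = k ≤ head v × sum v ≡ k + r

HeadFrom-last : ∀ {m} k → Layer k (SumIs 0) ≐ HeadFrom {m} k 0
HeadFrom-last {m} k = (λ {v} → to v) , λ {v} → from v
  where
  to : (v : Vec ℕ (suc m)) → Layer k (SumIs 0) v → HeadFrom k 0 v
  to (_ ∷ _) (refl , e) = ≤-refl , cong (k +_) e

  from : (v : Vec ℕ (suc m)) → HeadFrom k 0 v → Layer k (SumIs 0) v
  from (x ∷ v) (k≤x , e)
    with refl ← ≤-antisym k≤x
           -- The head is at most the whole sum, which is `k`.
           (≤-trans (m≤m+n x (sum v)) (≤-reflexive (trans e (+-identityʳ k))))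
    = refl , +-cancelˡ-≡ k _ _ e

HeadFrom-step : ∀ {m} k r →
  Layer k (SumIs (suc r)) ∪ HeadFrom (suc k) r ≐ HeadFrom {m} k (suc r)
HeadFrom-step {m} k r = (λ {v} → to v) , λ {v} → from v
  where
  to : (v : Vec ℕ (suc m)) → (Layer k (SumIs (suc r)) ∪ HeadFrom (suc k) r) v →
       HeadFrom k (suc r) v
  to (_ ∷ _) (inj₁ (refl , e)) = ≤-refl , cong (k +_) e
  to (_ ∷ _) (inj₂ (k<x , e))  = ≤-trans (n≤1+n k) k<x , trans e (sym (+-suc k r))

  from : (v : Vec ℕ (suc m)) → HeadFrom k (suc r) v →
         (Layer k (SumIs (suc r)) ∪ HeadFrom (suc k) r) v
  from (_ ∷ _) (k≤x , e) with m≤n⇒m<n∨m≡n k≤x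
  ... | inj₁ k<x  = inj₂ (k<x , trans e (+-suc k r))
  ... | inj₂ refl = inj₁ (refl , +-cancelˡ-≡ k _ _ e)

HeadFrom-0 : ∀ {m} n → HeadFrom {m} 0 n ≐ SumIs n
HeadFrom-0 n = proj₂ , (z≤n ,_)

-- Sweeping through the layers

RookPath : ∀ {m} → Pred (Vec ℕ m) 0ℓ → Vec ℕ m → Vec ℕ m → Set
RookPath = SpanningPath DifferInExactlyTwo

layerPath : ∀ {m} {P : Pred (Vec ℕ m) 0ℓ} {s t} k →
            RookPath P s t → RookPath (Layer k P) (k ∷ s) (k ∷ t)
layerPath k (spanning w d a c) = spanning
  (Walk-map ∷-same-differ-two w)
  (Unique.map⁺ ∷-injectiveʳ d)
  (All.map⁺ (All.map (refl ,_) a))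
  λ { {_ ∷ _} (refl , p) → ∈-map⁺ (k ∷_) (c p) }

module _ (m : ℕ) (path : ∀ r → RookPath (SumIs r) (lastCorner m r) (firstCorner m r)) where

  topLayer : ∀ k → RookPath (HeadFrom k 0)
    (k ∷ lastCorner m 0) (firstCorner (suc m) (k + 0))
  topLayer k = resp-≐ (HeadFrom-last k)
    (subst
      (λ x → RookPath (Layer k (SumIs 0)) (k ∷ lastCorner m 0) (x ∷ lastCorner m 0))
      (sym (+-identityʳ k))
      (layerPath k (subst (RookPath _ _) (corners-0 m) (path 0))))

  -- The connecting edge goes from `k ∷ t` to `suc k ∷ u`: one difference in the head and one in the
  -- tail.
  withLayer : ∀ {k r s t u} → RookPath (SumIs (suc r)) s t → DifferInExactlyOne t u →
              RookPath (HeadFrom (suc k) r) (suc k ∷ u) (firstCorner (suc m) (suc k + r)) →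
              RookPath (HeadFrom k (suc r)) (k ∷ s) (firstCorner (suc m) (k + suc r))
  withLayer {k} {r} p e q = resp-≐ (HeadFrom-step k r)
    (joined (λ { (refl , _) (k<k , _) → 1+n≰n k<k }) (layerPath k p)
      (∷-differ-two (1+n≢n ∘ sym) e)
      (subst (RookPath _ _) (cong (firstCorner (suc m)) (sym (+-suc k r))) q))

  -- The two sweeps alternate, as each layer is left at the kind of corner where the next is
  -- entered. The top layer is a single vector, so both end at the same corner whatever the parity
  -- of the number of layers.
  sweepDown : ∀ k r → RookPath (HeadFrom k r)
    (k ∷ lastCorner m r) (firstCorner (suc m) (k + r))
  sweepUp : ∀ k r → RookPath (HeadFrom k r)
    (k ∷ firstCorner m r) (firstCorner (suc m) (k + r))

  sweepDown k zero    = topLayer k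
  sweepDown k (suc r) =
    withLayer (path (suc r)) (firstCorner-differ m 1+n≢n) (sweepUp (suc k) r)

  sweepUp k zero    = subst
    (λ v → RookPath (HeadFrom k 0) (k ∷ v) (firstCorner (suc m) (k + 0)))
    (sym (corners-0 m)) (topLayer k)
  sweepUp k (suc r) =
    withLayer (reversed (λ {v w} → two-sym {a = v} {b = w}) (path (suc r)))
      (lastCorner-differ m 1+n≢n) (sweepDown (suc k) r)

-- Induction on `m` for all `n` at once, since the tails in different layers have different sums.
cornerPath : ∀ m n → RookPath (SumIs n) (lastCorner m n) (firstCorner m n)
cornerPath zero    n = resp-≐ (to , from) (singleton (n ∷ []))
  where
  to : ∀ {v} → v ≡ n ∷ [] → sum v ≡ n
  to refl = +-identityʳ n

  from : ∀ {v} → sum v ≡ n → v ≡ n ∷ []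
  from {x ∷ []} e = cong (_∷ []) (trans (sym (+-identityʳ x)) e)
cornerPath (suc m) n = resp-≐ (HeadFrom-0 n) (sweepDown m (cornerPath m) 0 n)

-- From the corner path to a Hamiltonian cycle

corners-adjacent : ∀ m {n} → n ≢ 0 →
  DifferInExactlyTwo (firstCorner (suc m) n) (lastCorner (suc m) n)
corners-adjacent m n≢0 = ∷-differ-two n≢0 (lastCorner-differ m (n≢0 ∘ sym))

vertex-≡ : ∀ {m n} {v w : Graph.Vertex (SR m n)} → proj₁ v ≡ proj₁ w → v ≡ w
vertex-≡ {v = _ , p} {w = _ , q} refl = cong (_ ,_) (≡-irrelevant p q)

-- The `sound` field supplies the sum proof that turns each vector on the path into a vertex;
-- uniqueness of these proofs makes the endpoints and the coverage agree.
liftPath : ∀ {m n} {s t : Graph.Vertex (SR m n)} →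
           RookPath (SumIs n) (proj₁ s) (proj₁ t) →
           SpanningPath (Graph._~_ (SR m n)) (λ _ → ⊤) s t
liftPath {m} {n} (spanning w d a c) = spanning
  (lift w a)
  (AllPairs.map (λ p → p ∘ cong proj₁)
    (AllPairs.map⁻ (subst Unique (sym (map-toList a)) d)))
  (All.universal _ _)
  λ {v} _ → covers v
  where
  map-toList : ∀ {xs} (a : All (SumIs {m} n) xs) → mapˡ proj₁ (All.toList a) ≡ xs
  map-toList []      = refl
  map-toList (_ ∷ a) = cong (_ ∷_) (map-toList a)

  lift : ∀ {x y xs p q} → Walk DifferInExactlyTwo x y xs → (a : All (SumIs n) xs) →
         Walk (Graph._~_ (SR m n)) (x , p) (y , q) (All.toList a)
  lift {p = p} {q} (stop _) (r ∷ [])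
    rewrite ≡-irrelevant p r | ≡-irrelevant q r = stop _
  lift {p = p} (e ∷ w) (r ∷ a) rewrite ≡-irrelevant p r =
    -- The next vertex needs its own sum proof, found in `a` because the vertex lies on the
    -- remaining walk.
    e ∷ lift {p = All.lookup a (Walk-start w)} w a

  covers : ∀ v → v ∈ All.toList a
  covers v with ∈-map⁻ proj₁ (subst (proj₁ v ∈_) (sym (map-toList a)) (c (proj₂ v)))
  ... | w , w∈ , e = subst (_∈ _) (sym (vertex-≡ e)) w∈

closeCycle : ∀ (G : Graph) {s t u} → SpanningPath (Graph._~_ G) (λ _ → ⊤) s t →
             Graph._~_ G t s → u ≢ s → u ≢ t → Hamiltonian G
-- On a one-vertex path the closing edge would be a loop.
closeCycle G (spanning (stop _) _ _ _) e _ _ = contradiction e (Graph.~-irrefl G refl)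
closeCycle G {s} (spanning w@(_ ∷ _) d _ c) e u≢s u≢t = record
  { start    = s
  ; long     = Walk-long w (λ s≡t → Graph.~-irrefl G (sym s≡t) e) (c _) u≢s u≢t
  ; distinct = d
  ; closed   = Walk-closed w e
  } , λ v → c _

cornerCycle : ∀ m {n} → n ≢ 0 → (v : Vec ℕ (suc (suc m))) → sum v ≡ n →
              v ≢ lastCorner (suc m) n → v ≢ firstCorner (suc m) n →
              Hamiltonian (SR (suc (suc m)) n)
cornerCycle m {n} n≢0 v e v≢last v≢first = closeCycle (SR _ n) {u = v , e}
  (liftPath {s = _ , sum-lastCorner (suc m) n} {t = _ , sum-firstCorner (suc m) n}
    (cornerPath (suc m) n))
  (corners-adjacent m n≢0)
  (v≢last ∘ cong proj₁)
  (v≢first ∘ cong proj₁)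

SR-hamiltonian : ∀ m n → n ≢ 0 → ¬ (m ≡ 0 × n ≡ 1) → Hamiltonian (SR (suc (suc m)) n)
SR-hamiltonian _       zero          n≢0 _  = contradiction refl n≢0
SR-hamiltonian zero    (suc zero)    _   ¬K₂ = contradiction (refl , refl) ¬K₂
SR-hamiltonian zero    (suc (suc n)) n≢0 _  =
  -- With two coordinates and sum at least 2, both entries of this third vertex are positive, unlike
  -- at a corner.
  cornerCycle 0 n≢0 (1 ∷ suc n ∷ []) (cong (2 +_) (+-identityʳ n)) (λ ()) (λ ())
SR-hamiltonian (suc m) (suc n)       n≢0 _  =
  -- With three or more coordinates, the corner of the second coordinate is a third vertex.
  cornerCycle (suc m) n≢0 (0 ∷ firstCorner (suc m) (suc n))
    (sum-firstCorner (suc m) (suc n)) (λ ()) (λ ())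

-- The exceptional cases

¬SR-1-hamiltonian : ∀ n → ¬ Hamiltonian (SR 1 n)
¬SR-1-hamiltonian n (record { rest = [] ; long = s≤s () } , _)
-- The first edge of the cycle would need two distinct elements of `Fin 1`.
¬SR-1-hamiltonian n (record { rest = _ ∷ _ ; closed = (zero , zero , 0≢0 , _) ∷ _ } , _) =
  0≢0 refl

SR-2-1-vertices : (v : Graph.Vertex (SR 2 1)) →
                  v ≡ (0 ∷ 1 ∷ [] , refl) ⊎ v ≡ (1 ∷ 0 ∷ [] , refl)
SR-2-1-vertices (0 ∷ 1 ∷ [] , refl) = inj₁ refl
SR-2-1-vertices (1 ∷ 0 ∷ [] , refl) = inj₂ refl

pigeonhole : ∀ {A : Set} {a b x y z : A} → x ≡ a ⊎ x ≡ b → y ≡ a ⊎ y ≡ b → z ≡ a ⊎ z ≡ b →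
             x ≡ y ⊎ x ≡ z ⊎ y ≡ z
pigeonhole (inj₁ refl) (inj₁ refl) _           = inj₁ refl
pigeonhole (inj₂ refl) (inj₂ refl) _           = inj₁ refl
pigeonhole (inj₁ refl) (inj₂ refl) (inj₁ refl) = inj₂ (inj₁ refl)
pigeonhole (inj₂ refl) (inj₁ refl) (inj₂ refl) = inj₂ (inj₁ refl)
pigeonhole (inj₁ refl) (inj₂ refl) (inj₂ refl) = inj₂ (inj₂ refl)
pigeonhole (inj₂ refl) (inj₁ refl) (inj₁ refl) = inj₂ (inj₂ refl)

-- There are only two vertices, so the first three on a cycle cannot be distinct.
¬SR-2-1-hamiltonian : ¬ Hamiltonian (SR 2 1)
¬SR-2-1-hamiltonian (record { rest = [] ; long = s≤s () } , _)
¬SR-2-1-hamiltonian (record { rest = _ ∷ [] ; long = s≤s (s≤s ()) } , _)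
¬SR-2-1-hamiltonian (record { start = x ; rest = y ∷ z ∷ _
                            ; distinct = (x≢y ∷ x≢z ∷ _) ∷ (y≢z ∷ _) ∷ _ } , _)
  with pigeonhole (SR-2-1-vertices x) (SR-2-1-vertices y) (SR-2-1-vertices z)
... | inj₁ x≡y        = x≢y x≡y
... | inj₂ (inj₁ x≡z) = x≢z x≡z
... | inj₂ (inj₂ y≡z) = y≢z y≡z

theorem3 : (m n : ℕ) → .{{_ : NonZero m}} → .{{_ : NonZero n}} →
    Hamiltonian (SR m n) ⇔ (¬ (m ≡ 1 ⊎ (m ≡ 2 × n ≡ 1)))
theorem3 m n = mk⇔ only-if (if m (≢-nonZero⁻¹ m))
  where
  only-if : Hamiltonian (SR m n) → ¬ (m ≡ 1 ⊎ (m ≡ 2 × n ≡ 1))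
  only-if h (inj₁ refl)          = ¬SR-1-hamiltonian n h
  only-if h (inj₂ (refl , refl)) = ¬SR-2-1-hamiltonian h

  if : ∀ m → m ≢ 0 → ¬ (m ≡ 1 ⊎ (m ≡ 2 × n ≡ 1)) → Hamiltonian (SR m n)
  if zero          m≢0 _ = contradiction refl m≢0
  if (suc zero)    _   ¬exc = contradiction (inj₁ refl) ¬exc
  if (suc (suc m)) _   ¬exc = SR-hamiltonian m n (≢-nonZero⁻¹ n)
    λ { (refl , refl) → ¬exc (inj₂ (refl , refl)) }
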